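{- Let $a=(a_1,a_2,\dots)$ be an infinite sequence of positive integers and let $k\ge 2$ be an integer such that $\gcd(a_1,\dots,a_k)=1$. Put $d_i=\gcd(a_1,\dots,a_i)$ for $i\ge 1$ and define the sequence $s^-_i$ ($i\ge1$) by $$s^-_1=-a_1,\qquad s^-_{i+1}=s^-_i+\left(\frac{d_i}{d_{i+1}}-1\right)a_{i+1}.$$ Then for every integer $n\ge 0$ with $n\ge s^-_k$, $$D^a_k(n)\ \ge\ \frac{1}{\prod_{i=1}^{k}a_i}\sum_{i=0}^{k-2}B^a_2(k-2,i)\,\frac{(n-s^-_k)^{k-1-i}}{(k-1-i)!},$$ where $B^a_2(k-2,i)$ denotes the Blom–Fröberg number with $r=2$.
   Context: For an infinite sequence $a=(a_1,a_2,\dots)$ of positive integers, an integer $k\ge1$ and an integer $n\ge 0$, the denumerant $D^a_k(n)$ is the number of $k$-tuples $(x_1,\dots,x_k)$ of non-negative integers with $a_1x_1+\dots+a_kx_k=n$. For such $a$, an integer $r\ge0$ and integers $m,\ell\in\mathbb{Z}$, the Blom–Fröberg number $B^a_r(m,\ell)$ is defined recursively by: $B^a_r(m,\ell)=0$ if $\ell<0$ or $\ell>m$; $B^a_r(0,0)=1$; and otherwise $$B^a_r(m,\ell)=B^a_r(m-1,\ell)+\frac{a_{m+r}}{2}\,B^a_r(m-1,\ell-1).$$ -}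

module Defs where

open import Data.Bool using (if_then_else_)
open import Data.Fin using (Fin; toℕ; zero; suc)
open import Data.Integer as ℤ using (ℤ; +_; -[1+_])
open import Data.List as List using (List; upTo; filter; cartesianProductWith)
open import Data.List.Membership.Propositional using (_∈_)
open import Data.List.Membership.Propositional.Properties using (∈-cartesianProductWith⁺; ∈-filter⁺; ∈-filter⁻; ∈-upTo⁺)
open import Data.List.Relation.Unary.All using ([])
open import Data.List.Relation.Unary.AllPairs using ([]; _∷_)
open import Data.List.Relation.Unary.Any using (here)
open import Data.List.Relation.Unary.Unique.Propositional using (Unique)
import Data.List.Relation.Unary.Unique.Propositional.Properties as Uniq
open import Data.Nat using (ℕ; zero; suc; _+_; _*_; _/_; _≤_; _<ᵇ_; NonZero; ≢-nonZero; ≢-nonZero⁻¹; s≤s)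
open import Data.Nat.GCD using (gcd; gcd[m,n]≢0)
open import Data.Nat.Properties using (_≟_; m*n≢0; m≤n*m; m≤m+n; m≤n+m; ≤-trans; ≤-reflexive)
open import Data.Product using (_,_; proj₂)
open import Data.Rational as ℚ using (ℚ; 0ℚ; 1ℚ)
open import Data.Sum using (inj₂)
open import Data.Vec as Vec using (Vec; []; _∷_; lookup; tabulate)
open import Data.Vec.Properties using (∷-injective)
open import Function using (_∘_; _⇔_; mk⇔)
open import Relation.Binary.PropositionalEquality using (_≡_; refl)

-- A sequence (a₁, a₂, …) is represented by a function a : ℕ → ℕ whose i-th
-- term is a i; the value a 0 is never used.  Positivity of the sequence is
-- the assumption  ∀ i → NonZero (a (suc i)).

∑[0≤i≤_] : ℕ → (ℕ → ℚ) → ℚ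
∑[0≤i≤ zero  ] f = f 0
∑[0≤i≤ suc m ] f = ∑[0≤i≤ m ] f ℚ.+ f (suc m)

-- x = (x₁, …, x_k) ↦ a₁ x₁ + … + a_k x_k
weight : (a : ℕ → ℕ) {k : ℕ} → Vec ℕ k → ℕ
weight a x = Vec.sum (tabulate λ i → a (suc (toℕ i)) * lookup x i)

-- all k-tuples with entries in {0, …, N}
tuples : (k N : ℕ) → List (Vec ℕ k)
tuples zero    N = [] List.∷ List.[]
tuples (suc k) N = cartesianProductWith _∷_ (upTo (suc N)) (tuples k N)

-- For a positive sequence, a solution of a₁ x₁ + … + a_k x_k = n has every
-- x_i ≤ n, so the search range loses nothing: see ∈-solutions and
-- solutions-unique below.
solutions : (a : ℕ → ℕ) (k n : ℕ) → List (Vec ℕ k)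
solutions a k n = filter (λ x → weight a x ≟ n) (tuples k n)

denumerant : (a : ℕ → ℕ) (k n : ℕ) → ℕ
denumerant a k n = List.length (solutions a k n)

blomFröberg : (a : ℕ → ℕ) (r : ℕ) (m ℓ : ℤ) → ℚ
blomFröberg a r -[1+ _ ]  ℓ         = 0ℚ  -- here ℓ < 0 or ℓ > m
blomFröberg a r (+ _)     -[1+ _ ]  = 0ℚ
blomFröberg a r (+ zero)  (+ zero)  = 1ℚ
blomFröberg a r (+ zero)  (+ suc _) = 0ℚ
blomFröberg a r (+ suc m) (+ ℓ)     =
  if suc m <ᵇ ℓ then 0ℚ else
    blomFröberg a r (+ m) (+ ℓ)
      ℚ.+ (+ a (suc m + r) ℚ./ 2) ℚ.* blomFröberg a r (+ m) (+ ℓ ℤ.- + 1)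

-- d a i = gcd (a₁, …, a_i)
d : (a : ℕ → ℕ) → ℕ → ℕ
d a zero    = 0
d a (suc i) = gcd (d a i) (a (suc i))

-- ∏ a k = a₁ ⋯ a_k
∏ : (a : ℕ → ℕ) → ℕ → ℕ
∏ a zero    = 1
∏ a (suc k) = ∏ a k * a (suc k)

module _ (a : ℕ → ℕ) (a⁺ : ∀ i → NonZero (a (suc i))) where

  d≢0 : ∀ i → NonZero (d a (suc i))
  d≢0 i = ≢-nonZero (gcd[m,n]≢0 (d a i) _ (inj₂ (≢-nonZero⁻¹ _ {{a⁺ i}})))

  ∏≢0 : ∀ k → NonZero (∏ a k)
  ∏≢0 zero    = _
  ∏≢0 (suc k) = m*n≢0 _ _ {{∏≢0 k}} {{a⁺ k}}

  -- The sequence starts at index 1; s⁻ 0 is a dummy value.  The natural-number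
  -- division is exact, since d_{i+1} divides d_i.
  s⁻ : ℕ → ℤ
  s⁻ zero          = + 0
  s⁻ (suc zero)    = ℤ.- (+ a 1)
  s⁻ (suc (suc j)) =
    let i = suc j
        instance _ = d≢0 i
    in s⁻ i ℤ.+ (+ (d a i / d a (suc i)) ℤ.- + 1) ℤ.* + a (suc i)

lookup-weight : (a : ℕ → ℕ) → (∀ i → NonZero (a (suc i))) →
                ∀ {k} (x : Vec ℕ k) i → lookup x i ≤ weight a x
lookup-weight a a⁺ (x ∷ xs) zero    = ≤-trans (m≤n*m x (a 1) {{a⁺ 0}}) (m≤m+n _ _)
lookup-weight a a⁺ (x ∷ xs) (suc i) =
  ≤-trans (lookup-weight (a ∘ suc) (a⁺ ∘ suc) xs i) (m≤n+m _ _)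

∈-tuples : ∀ {k N} (x : Vec ℕ k) → (∀ i → lookup x i ≤ N) → x ∈ tuples k N
∈-tuples []       x≤N = here refl
∈-tuples (x ∷ xs) x≤N =
  ∈-cartesianProductWith⁺ _∷_ (∈-upTo⁺ (s≤s (x≤N zero))) (∈-tuples xs (x≤N ∘ suc))

∈-solutions : (a : ℕ → ℕ) → (∀ i → NonZero (a (suc i))) →
              ∀ k n (x : Vec ℕ k) → x ∈ solutions a k n ⇔ weight a x ≡ n
∈-solutions a a⁺ k n x = mk⇔
  (λ x∈ → proj₂ (∈-filter⁻ (λ y → weight a y ≟ n) {xs = tuples k n} x∈))
  (λ eq → ∈-filter⁺ (λ y → weight a y ≟ n)
            (∈-tuples x λ i → ≤-trans (lookup-weight a a⁺ x i) (≤-reflexive eq)) eq)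

tuples-unique : ∀ k N → Unique (tuples k N)
tuples-unique zero    N = [] ∷ []
tuples-unique (suc k) N =
  Uniq.cartesianProductWith⁺ _∷_ ∷-injective (Uniq.upTo⁺ (suc N)) (tuples-unique k N)

solutions-unique : ∀ a k n → Unique (solutions a k n)
solutions-unique a k n = Uniq.filter⁺ (λ x → weight a x ≟ n) (tuples-unique k n)

{-# OPTIONS --safe #-}

-- By induction on k, D_k(n) ≥ f_k(n − s⁻_k) for every n ≥ 0 divisible by d_k with
-- n ≥ s⁻_k, where f_k(y) = (d_k / ∏ a_i) ∑ B(k−2, i) y^{k−1−i} / (k−1−i)!.
-- Put a = a_{k+1}, q = d_k / d_{k+1} and h = q a.  The x_{k+1} with d_k ∣ n − a x_{k+1}
-- form one residue class modulo q, so D_{k+1}(n) is a sum of values of D_k along a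
-- progression of step h, and passing to its first term costs at most
-- (q − 1) a = s⁻_{k+1} − s⁻_k.  The terms of f_k are convex powers vanishing at 0, so
-- the trapezoid rule bounds the sum of f_k along the progression from y below by
-- (1/h) ∫₀^y f_k + f_k(y) / 2.  Since h ≥ a, this dominates f_{k+1}(y) by the recursion
-- of the Blom–Fröberg numbers.  No term is lost at negative arguments: d_k divides
-- s⁻_k ≥ −d_k, so a negative multiple of d_k which is ≥ s⁻_k equals s⁻_k, and f_k(0) = 0.
-- The induction starts at k = 1 with f_1 the indicator function of y > 0.

module Submission where

open import Defs
open import Data.Bool using (true; false; T)
open import Data.Empty using (⊥-elim)
open import Data.Integer as ℤ using (+_)
import Data.Integer.Properties as ℤ
import Data.Integer.Tactic.RingSolver as ℤ-Solver
open import Algebra.Properties.AbelianGroup ℤ.+-0-abelianGroup using (∙-cancelʳ)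
open import Data.List as List using (List; []; _∷_; map; length)
open import Data.List.Membership.Propositional using (_∈_)
open import Data.List.Membership.Propositional.Properties
  using (∈-∃++; ∈-++⁻; ∈-++⁺ˡ; ∈-++⁺ʳ; ∈-map⁻)
open import Data.List.Properties using (length-map; length-++; length-++-sucʳ)
open import Data.List.Relation.Binary.Subset.Propositional using (_⊆_)
import Data.List.Relation.Unary.All as All
open import Data.List.Relation.Unary.AllPairs using ([]; _∷_)
open import Data.List.Relation.Unary.Any using (here; there)
open import Data.List.Relation.Unary.Unique.Propositional using (Unique)
import Data.List.Relation.Unary.Unique.Propositional.Properties as Uniq
open import Data.Nat
open import Data.Nat.DivMod using (m%n<n; m≡m%n+[m/n]*n; m/n*n≡m)
open import Data.Nat.Divisibility
open import Data.Nat.GCD using (gcd; gcd-GCD; gcd-identityˡ; gcd[m,n]∣m; gcd[m,n]∣n; module Bézout)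
open import Data.Nat.Induction using (<-wellFounded; Acc; acc)
open import Data.Nat.Properties
open import Data.Nat.Tactic.RingSolver using (solve-∀)
open import Data.Product using (∃-syntax; _×_; _,_; proj₁)
open import Data.Rational as ℚ using (ℚ; 0ℚ; 1ℚ)
import Data.Rational.Properties as ℚ
open import Data.Rational.Solver using (module +-*-Solver)
open import Data.Rational.Unnormalised as ℚᵘ using (mkℚᵘ; *≡*)
import Data.Rational.Unnormalised.Properties as ℚᵘ
open import Data.Sum using (_⊎_; inj₁; inj₂; [_,_]′)
open import Data.Unit using (tt)
open import Data.Vec using (Vec; []; _∷_; _∷ʳ_; initLast; last)
open import Data.Vec.Properties using (∷ʳ-injective; ∷ʳ-injectiveˡ; ∷ʳ-injectiveʳ)
open import Function using (_∘_; Equivalence)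
open import Relation.Binary.PropositionalEquality
open import Relation.Nullary using (contradiction; yes; no)

-- Counting solutions

-- Induction on `xs`: its head is cut out of `ys`, and by uniqueness the tail still lies in what
-- remains.
unique-⊆⇒length≤ : ∀ {A : Set} {xs ys : List A} →
                   Unique xs → xs ⊆ ys → length xs ≤ length ys
unique-⊆⇒length≤ [] _ = z≤n
unique-⊆⇒length≤ {xs = x ∷ xs} (x∉ ∷ u) sub with ∈-∃++ (sub (here refl))
... | ys₁ , ys₂ , refl =
  subst (suc (length xs) ≤_) (sym (length-++-sucʳ ys₁ x ys₂))
    (s≤s (unique-⊆⇒length≤ u λ z∈ → drop z∈ (∈-++⁻ ys₁ (sub (there z∈)))))
  where
  drop : ∀ {z} → z ∈ xs → z ∈ ys₁ ⊎ z ∈ x ∷ ys₂ → z ∈ ys₁ List.++ ys₂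
  drop z∈ (inj₁ p)           = ∈-++⁺ˡ p
  drop z∈ (inj₂ (here refl)) = contradiction refl (All.lookup x∉ z∈)
  drop z∈ (inj₂ (there p))   = ∈-++⁺ʳ ys₁ p

weight-∷ʳ : ∀ a {k} (xs : Vec ℕ k) x → weight a (xs ∷ʳ x) ≡ weight a xs + a (suc k) * x
weight-∷ʳ a []       x = +-identityʳ _
weight-∷ʳ a (y ∷ xs) x =
  trans (cong (λ z → a 1 * y + z) (weight-∷ʳ (a ∘ suc) xs x)) (sym (+-assoc (a 1 * y) _ _))

sucLast : ∀ {k} → Vec ℕ (suc k) → Vec ℕ (suc k)
sucLast v = proj₁ (initLast v) ∷ʳ suc (last v)

sucLast-injective : ∀ {k} {v w : Vec ℕ (suc k)} → sucLast v ≡ sucLast w → v ≡ w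
sucLast-injective {v = v} {w} eq with initLast v | initLast w
... | xs , x , refl | ys , y , refl with ∷ʳ-injective xs ys eq
... | refl , refl = refl

x+[y+z]≡x+z+y : ∀ x y z → x + (y + z) ≡ x + z + y
x+[y+z]≡x+z+y = solve-∀

weight-sucLast : ∀ a {k} (v : Vec ℕ (suc k)) → weight a (sucLast v) ≡ weight a v + a (suc k)
weight-sucLast a {k} v with initLast v
... | xs , x , refl rewrite weight-∷ʳ a xs (suc x) | weight-∷ʳ a xs x | *-suc (a (suc k)) x =
  x+[y+z]≡x+z+y (weight a xs) (a (suc k)) (a (suc k) * x)

module _ (a : ℕ → ℕ) (a⁺ : ∀ i → NonZero (a (suc i))) where

  -- The source of the lower bounds for denumerants: it suffices to exhibit a duplicate-free list of
  -- solutions.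
  length≤denumerant : ∀ {k n} {L : List (Vec ℕ k)} → Unique L →
                      (∀ {x} → x ∈ L → weight a x ≡ n) → length L ≤ denumerant a k n
  length≤denumerant {k} {n} u sol =
    unique-⊆⇒length≤ u λ {x} x∈ → Equivalence.from (∈-solutions a a⁺ k n x) (sol x∈)

  solution⇒weight : ∀ {k n x} → x ∈ solutions a k n → weight a x ≡ n
  solution⇒weight {k} {n} {x} = Equivalence.to (∈-solutions a a⁺ k n x)

  appendZero : ∀ k n → List (Vec ℕ (suc k))
  appendZero k n = map (_∷ʳ 0) (solutions a k n)

  appendZero-weight : ∀ {k n x} → x ∈ appendZero k n → weight a x ≡ n
  appendZero-weight {k} {n} x∈ with ∈-map⁻ (_∷ʳ 0) x∈
  ... | y , y∈ , refl = begin
    weight a (y ∷ʳ 0)            ≡⟨ weight-∷ʳ a y 0 ⟩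
    weight a y + a (suc k) * 0   ≡⟨ cong (λ z → weight a y + z) (*-zeroʳ (a (suc k))) ⟩
    weight a y + 0               ≡⟨ +-identityʳ _ ⟩
    weight a y                   ≡⟨ solution⇒weight y∈ ⟩
    n                            ∎
    where open ≡-Reasoning

  appendZero-unique : ∀ k n → Unique (appendZero k n)
  appendZero-unique k n = Uniq.map⁺ (λ {x} {y} → ∷ʳ-injectiveˡ x y) (solutions-unique a k n)

  denumerant-mono : ∀ k n → denumerant a k n ≤ denumerant a (suc k) n
  denumerant-mono k n = subst (_≤ denumerant a (suc k) n) (length-map _ (solutions a k n))
    (length≤denumerant (appendZero-unique k n) appendZero-weight)

  -- A solution counted by D_{k+1}(n + a_{k+1}) has last entry 0 or is obtained
  -- from one counted by D_{k+1}(n) by raising the last entry.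
  denumerant-+ : ∀ k n → denumerant a (suc k) n + denumerant a k (n + a (suc k))
                         ≤ denumerant a (suc k) (n + a (suc k))
  denumerant-+ k n = begin
    length old + length (solutions a k n′)
      ≡⟨ cong₂ _+_ (length-map sucLast old) (length-map _ (solutions a k n′)) ⟨
    length raised + length (appendZero k n′)      ≡⟨ length-++ raised ⟨
    length (raised List.++ appendZero k n′)
      ≤⟨ length≤denumerant
           (Uniq.++⁺ (Uniq.map⁺ sucLast-injective (solutions-unique a (suc k) n))
                     (appendZero-unique k n′) disjoint)
           ([ raised-weight , appendZero-weight ]′ ∘ ∈-++⁻ raised) ⟩
    denumerant a (suc k) n′ ∎
    where
    open ≤-Reasoning
    n′ = n + a (suc k)
    old = solutions a (suc k) n
    raised = map sucLast old
    raised-weight : ∀ {x} → x ∈ raised → weight a x ≡ n′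
    raised-weight x∈ with ∈-map⁻ sucLast x∈
    ... | y , y∈ , refl =
      trans (weight-sucLast a y) (cong (_+ a (suc k)) (solution⇒weight y∈))
    disjoint : ∀ {x} → x ∈ raised × x ∈ appendZero k n′ → _
    disjoint (p , q) with ∈-map⁻ sucLast p | ∈-map⁻ (_∷ʳ 0) q
    ... | y , _ , refl | z , _ , eq with ∷ʳ-injectiveʳ (proj₁ (initLast y)) z eq
    ... | ()

  denumerant-mono-* : ∀ k n j → denumerant a (suc k) n ≤ denumerant a (suc k) (n + j * a (suc k))
  denumerant-mono-* k n zero    = ≤-reflexive (cong (denumerant a (suc k)) (sym (+-identityʳ n)))
  denumerant-mono-* k n (suc j) rewrite x+[y+z]≡x+z+y n (a (suc k)) (j * a (suc k)) =
    ≤-trans (denumerant-mono-* k n j)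
      (≤-trans (m≤m+n _ _) (denumerant-+ k (n + j * a (suc k))))

  -- The shift by q coins consists of q - 1 shifts that use monotonicity only and a last one that
  -- uses `denumerant-+`; so q must be positive.
  denumerant-+* : ∀ k n q .{{_ : NonZero q}} →
                  denumerant a (suc k) n + denumerant a k (n + q * a (suc k))
                  ≤ denumerant a (suc k) (n + q * a (suc k))
  denumerant-+* k n (suc j) rewrite x+[y+z]≡x+z+y n (a (suc k)) (j * a (suc k)) =
    ≤-trans (+-monoˡ-≤ _ (denumerant-mono-* k n j)) (denumerant-+ k (n + j * a (suc k)))

-- Fractions of natural numbers

infixl 8 _÷_

_÷_ : (m n : ℕ) .{{_ : NonZero n}} → ℚ
m ÷ n = + m ℚ./ n

-- `ℚ._/_` reduces fractions to lowest terms, so the cross-multiplication takes place among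
-- unnormalised rationals.
÷-mono : ∀ m n m′ n′ .{{_ : NonZero n}} .{{_ : NonZero n′}} → m * n′ ≤ m′ * n → m ÷ n ℚ.≤ m′ ÷ n′
÷-mono m n@(suc _) m′ n′@(suc _) le = ℚ.toℚᵘ-cancel-≤ (begin
  ℚ.toℚᵘ (m ÷ n)      ≃⟨ ℚ.toℚᵘ-fromℚᵘ (mkℚᵘ (+ m) (pred n)) ⟩
  mkℚᵘ (+ m) (pred n)     ≤⟨ ℚᵘ.*≤* (subst₂ ℤ._≤_ (ℤ.pos-* m n′) (ℤ.pos-* m′ n) (ℤ.+≤+ le)) ⟩
  mkℚᵘ (+ m′) (pred n′)   ≃⟨ ℚ.toℚᵘ-fromℚᵘ (mkℚᵘ (+ m′) (pred n′)) ⟨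
  ℚ.toℚᵘ (m′ ÷ n′)    ∎)
  where open ℚᵘ.≤-Reasoning

÷-cong : ∀ m n m′ n′ .{{_ : NonZero n}} .{{_ : NonZero n′}} → m * n′ ≡ m′ * n → m ÷ n ≡ m′ ÷ n′
÷-cong m n m′ n′ eq =
  ℚ.≤-antisym (÷-mono m n m′ n′ (≤-reflexive eq)) (÷-mono m′ n′ m n (≤-reflexive (sym eq)))

÷-* : ∀ m n m′ n′ .{{_ : NonZero n}} .{{_ : NonZero n′}} .{{_ : NonZero (n * n′)}} →
      (m ÷ n) ℚ.* (m′ ÷ n′) ≡ (m * m′) ÷ (n * n′)
÷-* m n@(suc _) m′ n′@(suc _) = ℚ.toℚᵘ-injective (begin
  ℚ.toℚᵘ (m ÷ n ℚ.* m′ ÷ n′)            ≈⟨ ℚ.toℚᵘ-homo-* (m ÷ n) (m′ ÷ n′) ⟩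
  ℚ.toℚᵘ (m ÷ n) ℚᵘ.* ℚ.toℚᵘ (m′ ÷ n′)
    ≈⟨ ℚᵘ.*-cong (ℚ.toℚᵘ-fromℚᵘ (mkℚᵘ (+ m) (pred n)))
                  (ℚ.toℚᵘ-fromℚᵘ (mkℚᵘ (+ m′) (pred n′))) ⟩
  mkℚᵘ (+ m) (pred n) ℚᵘ.* mkℚᵘ (+ m′) (pred n′)
    ≡⟨ cong (λ z → mkℚᵘ z (pred (n * n′))) (ℤ.pos-* m m′) ⟨
  mkℚᵘ (+ (m * m′)) (pred (n * n′))
    ≈⟨ ℚ.toℚᵘ-fromℚᵘ (mkℚᵘ (+ (m * m′)) (pred (n * n′))) ⟨
  ℚ.toℚᵘ ((m * m′) ÷ (n * n′))          ∎)
  where open import Relation.Binary.Reasoning.Setoid ℚᵘ.≃-setoid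

÷-+ : ∀ m m′ n .{{_ : NonZero n}} → m ÷ n ℚ.+ m′ ÷ n ≡ (m + m′) ÷ n
÷-+ m m′ n@(suc _) = ℚ.toℚᵘ-injective (begin
  ℚ.toℚᵘ (m ÷ n ℚ.+ m′ ÷ n)             ≈⟨ ℚ.toℚᵘ-homo-+ (m ÷ n) (m′ ÷ n) ⟩
  ℚ.toℚᵘ (m ÷ n) ℚᵘ.+ ℚ.toℚᵘ (m′ ÷ n)
    ≈⟨ ℚᵘ.+-cong (ℚ.toℚᵘ-fromℚᵘ (mkℚᵘ (+ m) (pred n)))
                  (ℚ.toℚᵘ-fromℚᵘ (mkℚᵘ (+ m′) (pred n))) ⟩
  mkℚᵘ (+ m) (pred n) ℚᵘ.+ mkℚᵘ (+ m′) (pred n)     ≈⟨ *≡* eq ⟩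
  mkℚᵘ (+ (m + m′)) (pred n)                ≈⟨ ℚ.toℚᵘ-fromℚᵘ (mkℚᵘ (+ (m + m′)) (pred n)) ⟨
  ℚ.toℚᵘ ((m + m′) ÷ n)                 ∎)
  where
  open import Relation.Binary.Reasoning.Setoid ℚᵘ.≃-setoid
  eq : (+ m ℤ.* + n ℤ.+ + m′ ℤ.* + n) ℤ.* + n ≡ + (m + m′) ℤ.* + (n * n)
  eq = trans (cong (ℤ._* + n) (sym (ℤ.*-distribʳ-+ (+ n) (+ m) (+ m′))))
        (trans (ℤ.*-assoc (+ (m + m′)) (+ n) (+ n)) (cong (+ (m + m′) ℤ.*_) (sym (ℤ.pos-* n n))))

ι : ℕ → ℚ
ι n = n ÷ 1

ι-mono : ∀ {m n} → m ≤ n → ι m ℚ.≤ ι n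
ι-mono {m} {n} m≤n = ÷-mono m 1 n 1 (*-monoˡ-≤ 1 m≤n)

ι-+ : ∀ m n → ι (m + n) ≡ ι m ℚ.+ ι n
ι-+ m n = sym (÷-+ m n 1)

÷-nonNeg : ∀ m n .{{_ : NonZero n}} → ℚ.NonNegative (m ÷ n)
÷-nonNeg m n = ℚ.nonNegative (÷-mono 0 1 m n z≤n)

-- Inequalities between powers

-- Bernoulli's inequality in homogeneous form: the tangent of a power at y lies below it. In the
-- induction, multiplying by y + h leaves a surplus in h².
bernoulli : ∀ e y h → y ^ suc e + suc e * (h * y ^ e) ≤ (y + h) ^ suc e
bernoulli zero    y h = ≤-reflexive (rearrange y h)
  where
  rearrange : ∀ y h → y * 1 + (h * 1 + 0) ≡ (y + h) * 1
  rearrange = solve-∀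
bernoulli (suc e) y h = begin
  y * (y * p) + suc (suc e) * (h * (y * p))               ≤⟨ m≤m+n _ (suc e * (h * h * p)) ⟩
  _                                                       ≡⟨ rearrange y p h e ⟩
  (y + h) * (y * p + suc e * (h * p))                     ≤⟨ *-monoʳ-≤ (y + h) (bernoulli e y h) ⟩
  (y + h) * (y + h) ^ suc e                               ∎
  where
  open ≤-Reasoning
  p = y ^ e
  rearrange : ∀ y p h e → y * (y * p) + suc (suc e) * (h * (y * p)) + suc e * (h * h * p)
                    ≡ (y + h) * (y * p + suc e * (h * p))
  rearrange = solve-∀

-- The trapezoid bound for ∫ x^e over [y, y + h].
trapezoid : ∀ e y h → 2 * (y + h) ^ suc e ≤ 2 * y ^ suc e + suc e * (h * ((y + h) ^ e + y ^ e))
trapezoid zero    y h = ≤-reflexive (rearrange y h)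
  where
  rearrange : ∀ y h → 2 * ((y + h) * 1) ≡ 2 * (y * 1) + 1 * (h * 2)
  rearrange = solve-∀
trapezoid (suc e) y h = begin
  2 * (z * z ^ suc e)                                         ≡⟨ rearrange₁ z (z ^ suc e) ⟩
  z * (2 * z ^ suc e)                                         ≤⟨ *-monoʳ-≤ z (trapezoid e y h) ⟩
  z * (2 * y ^ suc e + suc e * (h * (z ^ e + y ^ e)))         ≡⟨ rearrange₂ y (y ^ e) h e (z ^ e) ⟩
  2 * (y * y ^ suc e) + suc e * (h * (z ^ suc e + y ^ suc e))
    + h * (y ^ suc e + (y ^ suc e + suc e * (h * y ^ e)))
    -- In the last summand, y^(e+1) + (e + 1) h y^e is the tangent bound for z^(e+1).
    ≤⟨ +-monoʳ-≤ (2 * (y * y ^ suc e) + suc e * (h * (z ^ suc e + y ^ suc e)))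
         (*-monoʳ-≤ h (+-monoʳ-≤ (y ^ suc e) (bernoulli e y h))) ⟩
  2 * (y * y ^ suc e) + suc e * (h * (z ^ suc e + y ^ suc e)) + h * (y ^ suc e + z ^ suc e)
    ≡⟨ rearrange₃ (y * y ^ suc e) e h (z ^ suc e) (y ^ suc e) ⟩
  2 * (y * y ^ suc e) + suc (suc e) * (h * (z ^ suc e + y ^ suc e)) ∎
  where
  open ≤-Reasoning
  z = y + h
  rearrange₁ : ∀ z p → 2 * (z * p) ≡ z * (2 * p)
  rearrange₁ = solve-∀
  rearrange₂ : ∀ y p h e r → (y + h) * (2 * (y * p) + suc e * (h * (r + p)))
         ≡ 2 * (y * (y * p)) + suc e * (h * ((y + h) * r + y * p)) + h * (y * p + (y * p + suc e * (h * p)))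
  rearrange₂ = solve-∀
  rearrange₃ : ∀ x e h r s → 2 * x + suc e * (h * (r + s)) + h * (s + r) ≡ 2 * x + suc (suc e) * (h * (r + s))
  rearrange₃ = solve-∀

-- This is y^(e+1)/(e+1)! + (a/2) y^e/e! ≤ h y^e/e!, multiplied by 2 (e+1)!. Once y and a are
-- replaced by h it amounts to 2 + (e + 1) ≤ 2 (e + 1), which is where e ≥ 1 enters.
power-small : ∀ e .{{_ : NonZero e}} {y a h} → y ≤ h → a ≤ h →
             2 * y ^ suc e + a * suc e * y ^ e ≤ 2 * h * suc e * y ^ e
power-small e@(suc e-1) {y} {a} {h} y≤h a≤h = begin
  2 * (y * y ^ e) + a * suc e * y ^ e
    ≤⟨ +-mono-≤ (*-monoʳ-≤ 2 (*-monoˡ-≤ (y ^ e) y≤h))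
                (*-monoˡ-≤ (y ^ e) (*-monoˡ-≤ (suc e) a≤h)) ⟩
  2 * (h * y ^ e) + h * suc e * y ^ e                  ≤⟨ m≤m+n _ (e-1 * (h * y ^ e)) ⟩
  _                                                    ≡⟨ rearrange h (y ^ e) e-1 ⟩
  2 * h * suc e * y ^ e                                ∎
  where
  open ≤-Reasoning
  rearrange : ∀ h p e → 2 * (h * p) + h * suc (suc e) * p + e * (h * p) ≡ 2 * h * suc (suc e) * p
  rearrange = solve-∀

-- The trapezoid rule gives both endpoints weight h/2. On the left only a/2 is kept; the surplus (h
-- - a)/2 moves to the right endpoint, where the power is at least as large.
power-step : ∀ e y {a h} → a ≤ h →
            2 * (y + h) ^ suc e + a * suc e * (y + h) ^ e
            ≤ (2 * y ^ suc e + a * suc e * y ^ e) + 2 * h * suc e * (y + h) ^ e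
power-step e y {a} {h} a≤h with m≤n⇒∃[o]m+o≡n a≤h
... | b , refl = begin
  2 * z ^ suc e + a * suc e * r
    ≤⟨ +-monoˡ-≤ _ (trapezoid e y (a + b)) ⟩
  2 * y ^ suc e + suc e * ((a + b) * (r + p)) + a * suc e * r
    ≡⟨ rearrange₁ (y ^ suc e) e a b r p ⟩
  2 * y ^ suc e + a * suc e * p + (2 * a + b) * suc e * r + b * suc e * p
    ≤⟨ +-monoʳ-≤ (2 * y ^ suc e + a * suc e * p + (2 * a + b) * suc e * r)
         (*-monoʳ-≤ (b * suc e) (^-monoˡ-≤ e (m≤m+n y (a + b)))) ⟩
  2 * y ^ suc e + a * suc e * p + (2 * a + b) * suc e * r + b * suc e * r
    ≡⟨ rearrange₂ (y ^ suc e) e a b r p ⟩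
  (2 * y ^ suc e + a * suc e * p) + 2 * (a + b) * suc e * r         ∎
  where
  open ≤-Reasoning
  z = y + (a + b)
  r = z ^ e
  p = y ^ e
  rearrange₁ : ∀ x e a b r p → 2 * x + suc e * ((a + b) * (r + p)) + a * suc e * r
         ≡ 2 * x + a * suc e * p + (2 * a + b) * suc e * r + b * suc e * p
  rearrange₁ = solve-∀
  rearrange₂ : ∀ x e a b r p → 2 * x + a * suc e * p + (2 * a + b) * suc e * r + b * suc e * r
         ≡ (2 * x + a * suc e * p) + 2 * (a + b) * suc e * r
  rearrange₂ = solve-∀

-- Divided powers y^e / e!

pw : ℕ → ℕ → ℚ
pw y e = _÷_ (y ^ e) (e !) {{e !≢0}}

pw-mono : ∀ e {y z} → y ≤ z → pw y e ℚ.≤ pw z e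
pw-mono e {y} {z} y≤z =
  ÷-mono (y ^ e) (e !) (z ^ e) (e !) {{e !≢0}} {{e !≢0}} (*-monoˡ-≤ (e !) (^-monoˡ-≤ e y≤z))

pw-zero : ∀ e → pw 0 (suc e) ≡ 0ℚ
pw-zero e = ÷-cong 0 (suc e !) 0 1 {{suc e !≢0}} refl

module _ (e : ℕ) where
  private
    -- Common denominator of the three kinds of terms below; clearing it leaves `power-step` and
    -- `power-small`.
    N = 2 * suc e !
    instance
      e≢0 : NonZero (e !)
      e≢0 = e !≢0
      se≢0 : NonZero (suc e !)
      se≢0 = suc e !≢0
      N≢0 : NonZero N
      N≢0 = m*n≢0 2 (suc e !)
      2*e!≢0 : NonZero (2 * e !)
      2*e!≢0 = m*n≢0 2 (e !)
      1*e!≢0 : NonZero (1 * e !)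
      1*e!≢0 = m*n≢0 1 (e !)

  pw-suc-÷ : ∀ y → pw y (suc e) ≡ (2 * y ^ suc e) ÷ N
  pw-suc-÷ y = ÷-cong (y ^ suc e) (suc e !) (2 * y ^ suc e) N (rearrange (y ^ suc e) (suc e !))
    where
    rearrange : ∀ x y → x * (2 * y) ≡ 2 * x * y
    rearrange = solve-∀

  half*pw-÷ : ∀ a y → (a ÷ 2) ℚ.* pw y e ≡ (a * suc e * y ^ e) ÷ N
  half*pw-÷ a y = trans (÷-* a 2 (y ^ e) (e !))
    (÷-cong (a * y ^ e) (2 * e !) (a * suc e * y ^ e) N (rearrange a (y ^ e) e (e !)))
    where
    rearrange : ∀ a x e y → a * x * (2 * (suc e * y)) ≡ a * suc e * x * (2 * y)
    rearrange = solve-∀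

  ι*pw-÷ : ∀ h y → ι h ℚ.* pw y e ≡ (2 * h * suc e * y ^ e) ÷ N
  ι*pw-÷ h y = trans (÷-* h 1 (y ^ e) (e !))
    (÷-cong (h * y ^ e) (1 * e !) (2 * h * suc e * y ^ e) N (rearrange h (y ^ e) e (e !)))
    where
    rearrange : ∀ a x e y → a * x * (2 * (suc e * y)) ≡ 2 * a * suc e * x * (1 * y)
    rearrange = solve-∀

  -- The combination with `a ÷ 2` is what the Blom-Fröberg recursion makes of a single divided
  -- power, so this is the growth over one step of length h, term by term.
  pw-step : ∀ y {a h} → a ≤ h →
    pw (y + h) (suc e) ℚ.+ (a ÷ 2) ℚ.* pw (y + h) e
    ℚ.≤ (pw y (suc e) ℚ.+ (a ÷ 2) ℚ.* pw y e) ℚ.+ ι h ℚ.* pw (y + h) e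
  pw-step y {a} {h} a≤h = begin
    pw (y + h) (suc e) ℚ.+ (a ÷ 2) ℚ.* pw (y + h) e   ≡⟨ sum-÷ (y + h) ⟩
    (2 * (y + h) ^ suc e + a * suc e * (y + h) ^ e) ÷ N
      ≤⟨ ÷-mono (2 * (y + h) ^ suc e + a * suc e * (y + h) ^ e) N
                (2 * y ^ suc e + a * suc e * y ^ e + 2 * h * suc e * (y + h) ^ e) N
                (*-monoˡ-≤ N (power-step e y a≤h)) ⟩
    (2 * y ^ suc e + a * suc e * y ^ e + 2 * h * suc e * (y + h) ^ e) ÷ N
      ≡⟨ ÷-+ (2 * y ^ suc e + a * suc e * y ^ e) (2 * h * suc e * (y + h) ^ e) N ⟨
    (2 * y ^ suc e + a * suc e * y ^ e) ÷ N ℚ.+ (2 * h * suc e * (y + h) ^ e) ÷ N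
      ≡⟨ cong₂ ℚ._+_ (sum-÷ y) (ι*pw-÷ h (y + h)) ⟨
    (pw y (suc e) ℚ.+ (a ÷ 2) ℚ.* pw y e) ℚ.+ ι h ℚ.* pw (y + h) e ∎
    where
    open ℚ.≤-Reasoning
    sum-÷ : ∀ y → pw y (suc e) ℚ.+ (a ÷ 2) ℚ.* pw y e ≡ (2 * y ^ suc e + a * suc e * y ^ e) ÷ N
    sum-÷ y = trans (cong₂ ℚ._+_ (pw-suc-÷ y) (half*pw-÷ a y))
      (÷-+ (2 * y ^ suc e) (a * suc e * y ^ e) N)

  pw-small : ∀ {y a h} .{{_ : NonZero e}} → y ≤ h → a ≤ h →
    pw y (suc e) ℚ.+ (a ÷ 2) ℚ.* pw y e ℚ.≤ ι h ℚ.* pw y e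
  pw-small {y} {a} {h} y≤h a≤h = begin
    pw y (suc e) ℚ.+ (a ÷ 2) ℚ.* pw y e               ≡⟨ cong₂ ℚ._+_ (pw-suc-÷ y) (half*pw-÷ a y) ⟩
    (2 * y ^ suc e) ÷ N ℚ.+ (a * suc e * y ^ e) ÷ N   ≡⟨ ÷-+ (2 * y ^ suc e) (a * suc e * y ^ e) N ⟩
    (2 * y ^ suc e + a * suc e * y ^ e) ÷ N
      ≤⟨ ÷-mono (2 * y ^ suc e + a * suc e * y ^ e) N (2 * h * suc e * y ^ e) N
                (*-monoˡ-≤ N (power-small e y≤h a≤h)) ⟩
    (2 * h * suc e * y ^ e) ÷ N                       ≡⟨ ι*pw-÷ h y ⟨
    ι h ℚ.* pw y e                                    ∎
    where open ℚ.≤-Reasoning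

-- Finite sums

∑-mono : ∀ m {f g} → (∀ i → i ≤ m → f i ℚ.≤ g i) → ∑[0≤i≤ m ] f ℚ.≤ ∑[0≤i≤ m ] g
∑-mono zero    f≤g = f≤g 0 z≤n
∑-mono (suc m) f≤g = ℚ.+-mono-≤ (∑-mono m λ i i≤m → f≤g i (m≤n⇒m≤1+n i≤m)) (f≤g (suc m) ≤-refl)

∑-cong : ∀ m {f g} → (∀ i → i ≤ m → f i ≡ g i) → ∑[0≤i≤ m ] f ≡ ∑[0≤i≤ m ] g
∑-cong m eq = ℚ.≤-antisym (∑-mono m λ i p → ℚ.≤-reflexive (eq i p))
                          (∑-mono m λ i p → ℚ.≤-reflexive (sym (eq i p)))

∑-+ : ∀ m f g → ∑[0≤i≤ m ] (λ i → f i ℚ.+ g i) ≡ ∑[0≤i≤ m ] f ℚ.+ ∑[0≤i≤ m ] g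
∑-+ zero    f g = refl
∑-+ (suc m) f g = trans (cong (ℚ._+ (f (suc m) ℚ.+ g (suc m))) (∑-+ m f g))
  (solve 4 (λ a b c d → (a :+ b) :+ (c :+ d) := (a :+ c) :+ (b :+ d)) refl
    (∑[0≤i≤ m ] f) (∑[0≤i≤ m ] g) (f (suc m)) (g (suc m)))
  where open +-*-Solver

∑-*ˡ : ∀ m r f → ∑[0≤i≤ m ] (λ i → r ℚ.* f i) ≡ r ℚ.* ∑[0≤i≤ m ] f
∑-*ˡ zero    r f = refl
∑-*ˡ (suc m) r f = trans (cong (ℚ._+ (r ℚ.* f (suc m))) (∑-*ˡ m r f)) (sym (ℚ.*-distribˡ-+ r _ _))

∑-suc : ∀ m f → ∑[0≤i≤ suc m ] f ≡ f 0 ℚ.+ ∑[0≤i≤ m ] (λ i → f (suc i))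
∑-suc zero    f = refl
∑-suc (suc m) f = trans (cong (ℚ._+ f (suc (suc m))) (∑-suc m f))
  (ℚ.+-assoc (f 0) (∑[0≤i≤ m ] (λ i → f (suc i))) (f (suc (suc m))))

-- Blom-Fröberg numbers and the sums they weight

module _ (a : ℕ → ℕ) where

  private
    B : ℕ → ℕ → ℚ
    B m i = blomFröberg a 2 (+ m) (+ i)

    -- The coefficient in row m + 1 of the recursion; its index m + 3 is that of the coin added to m
    -- + 2 coins.
    α : ℕ → ℚ
    α m = a (suc m + 2) ÷ 2

  B-vanish : ∀ m i → m < i → B m i ≡ 0ℚ
  B-vanish zero    (suc i) _   = refl
  B-vanish (suc m) i       m<i with suc m <ᵇ i | <⇒<ᵇ m<i
  ... | true | _ = refl

  -- At ℓ = 0 the recursion refers to ℓ = -1, where the number is 0 by definition.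
  B-suc-zero : ∀ m → B (suc m) 0 ≡ B m 0
  B-suc-zero m = trans (cong (B m 0 ℚ.+_) (ℚ.*-zeroʳ (α m))) (ℚ.+-identityʳ _)

  B-suc-suc : ∀ m i → i ≤ m → B (suc m) (suc i) ≡ B m (suc i) ℚ.+ α m ℚ.* B m i
  B-suc-suc m i i≤m with m <ᵇ i in eq
  ... | false = refl
  ... | true  = ⊥-elim (<⇒≱ (<ᵇ⇒< m i (subst T (sym eq) tt)) i≤m)

  B-nonNeg : ∀ m i → ℚ.NonNegative (B m i)
  B-nonNeg zero    zero    = _
  B-nonNeg zero    (suc i) = _
  B-nonNeg (suc m) zero    = subst ℚ.NonNegative (sym (B-suc-zero m)) (B-nonNeg m 0)
  B-nonNeg (suc m) (suc i) with i ≤? m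
  ... | yes i≤m = subst ℚ.NonNegative (sym (B-suc-suc m i i≤m))
        (ℚ.nonNeg+nonNeg⇒nonNeg (B m (suc i)) {{B-nonNeg m (suc i)}} (α m ℚ.* B m i)
          {{ℚ.nonNeg*nonNeg⇒nonNeg (α m) {{÷-nonNeg (a (suc m + 2)) 2}} (B m i) {{B-nonNeg m i}}}})
  ... | no i≰m = subst ℚ.NonNegative (sym (B-vanish (suc m) (suc i) (s≤s (≰⇒> i≰m)))) _

  -- With `φ = pw y` this is the sum of the theorem for k = m + 2. For general `φ` it is a linear
  -- functional, so identities and inequalities can be checked exponent by exponent.
  bfSum : ℕ → (ℕ → ℚ) → ℚ
  bfSum m φ = ∑[0≤i≤ m ] (λ i → B m i ℚ.* φ (suc m ∸ i))

  -- The weights are nonnegative, and i ≤ m makes every exponent m + 1 - i positive, so `φ` and `ψ`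
  -- are compared at positive exponents only.
  bfSum-mono : ∀ m {φ ψ} → (∀ e .{{_ : NonZero e}} → φ e ℚ.≤ ψ e) → bfSum m φ ℚ.≤ bfSum m ψ
  bfSum-mono m {φ} {ψ} φ≤ψ = ∑-mono m λ i i≤m →
    ℚ.*-monoˡ-≤-nonNeg (B m i) {{B-nonNeg m i}}
      (φ≤ψ (suc m ∸ i) {{>-nonZero (m<n⇒0<n∸m (s≤s i≤m))}})

  bfSum-cong : ∀ m {φ ψ} → (∀ e .{{_ : NonZero e}} → φ e ≡ ψ e) → bfSum m φ ≡ bfSum m ψ
  bfSum-cong m φ≡ψ = ℚ.≤-antisym (bfSum-mono m λ e → ℚ.≤-reflexive (φ≡ψ e))
                                 (bfSum-mono m λ e → ℚ.≤-reflexive (sym (φ≡ψ e)))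

  bfSum-+ : ∀ m φ ψ → bfSum m (λ e → φ e ℚ.+ ψ e) ≡ bfSum m φ ℚ.+ bfSum m ψ
  bfSum-+ m φ ψ = trans (∑-cong m λ i _ → ℚ.*-distribˡ-+ (B m i) _ _) (∑-+ m _ _)

  bfSum-* : ∀ m r φ → bfSum m (λ e → r ℚ.* φ e) ≡ r ℚ.* bfSum m φ
  bfSum-* m r φ = trans (∑-cong m λ i _ → x*[y*z]≡y*[x*z] (B m i) r (φ (suc m ∸ i))) (∑-*ˡ m r _)
    where
    open +-*-Solver
    x*[y*z]≡y*[x*z] : ∀ x y z → x ℚ.* (y ℚ.* z) ≡ y ℚ.* (x ℚ.* z)
    x*[y*z]≡y*[x*z] = solve 3 (λ x y z → x :* (y :* z) := y :* (x :* z)) refl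

  -- The recursion splits each weight in two; after an index shift both halves are sums over row m.
  bfSum-suc : ∀ m φ → bfSum (suc m) φ ≡ bfSum m (λ e → φ (suc e) ℚ.+ α m ℚ.* φ e)
  bfSum-suc m φ = begin
    bfSum (suc m) φ
      ≡⟨ ∑-suc m (λ i → B (suc m) i ℚ.* φ (suc (suc m) ∸ i)) ⟩
    B (suc m) 0 ℚ.* φ (suc (suc m)) ℚ.+ ∑[0≤i≤ m ] (λ i → B (suc m) (suc i) ℚ.* φ (suc m ∸ i))
      ≡⟨ cong₂ ℚ._+_ (cong (ℚ._* φ (suc (suc m))) (B-suc-zero m))
           (∑-cong m λ i i≤m → trans (cong (ℚ._* φ (suc m ∸ i)) (B-suc-suc m i i≤m))
                                     (ℚ.*-distribʳ-+ (φ (suc m ∸ i)) (B m (suc i)) (α m ℚ.* B m i))) ⟩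
    B m 0 ℚ.* φ (suc (suc m)) ℚ.+ ∑[0≤i≤ m ] (λ i → up (suc i) ℚ.+ α m ℚ.* B m i ℚ.* φ (suc m ∸ i))
      ≡⟨ cong (up 0 ℚ.+_) (∑-+ m _ _) ⟩
    up 0 ℚ.+ (∑[0≤i≤ m ] (λ i → up (suc i)) ℚ.+ low)
      ≡⟨ ℚ.+-assoc (up 0) _ _ ⟨
    (up 0 ℚ.+ ∑[0≤i≤ m ] (λ i → up (suc i))) ℚ.+ low
      ≡⟨ cong (ℚ._+ low) (∑-suc m up) ⟨
    (∑[0≤i≤ m ] up ℚ.+ up (suc m)) ℚ.+ low
      -- The extra top term has weight B(m, m + 1) = 0.
      ≡⟨ cong (λ z → (∑[0≤i≤ m ] up ℚ.+ z) ℚ.+ low)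
           (trans (cong (ℚ._* φ (suc (suc m) ∸ suc m)) (B-vanish m (suc m) ≤-refl))
                  (ℚ.*-zeroˡ (φ (suc (suc m) ∸ suc m)))) ⟩
    (∑[0≤i≤ m ] up ℚ.+ 0ℚ) ℚ.+ low
      ≡⟨ cong (ℚ._+ low) (ℚ.+-identityʳ (∑[0≤i≤ m ] up)) ⟩
    ∑[0≤i≤ m ] up ℚ.+ low
      ≡⟨ ∑-+ m _ _ ⟨
    ∑[0≤i≤ m ] (λ i → up i ℚ.+ α m ℚ.* B m i ℚ.* φ (suc m ∸ i))
      ≡⟨ ∑-cong m (λ i i≤m → trans
           (cong (λ e → B m i ℚ.* φ e ℚ.+ α m ℚ.* B m i ℚ.* φ (suc m ∸ i))
                 (+-∸-assoc 1 (m≤n⇒m≤1+n i≤m)))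
           (rearrange (B m i) (φ (suc (suc m ∸ i))) (α m) (φ (suc m ∸ i)))) ⟩
    bfSum m (λ e → φ (suc e) ℚ.+ α m ℚ.* φ e) ∎
    where
    open ≡-Reasoning
    open +-*-Solver using (solve; _:=_; _:+_; _:*_)
    up : ℕ → ℚ
    up i = B m i ℚ.* φ (suc (suc m) ∸ i)
    low = ∑[0≤i≤ m ] (λ i → α m ℚ.* B m i ℚ.* φ (suc m ∸ i))
    rearrange : ∀ b x α y → b ℚ.* x ℚ.+ α ℚ.* b ℚ.* y ≡ b ℚ.* (x ℚ.+ α ℚ.* y)
    rearrange = solve 4 (λ b x α y → b :* x :+ α :* b :* y := b :* (x :+ α :* y)) refl

-- Adding one coin

∣∧<⇒+≤ : ∀ {d m n} .{{_ : NonZero d}} → d ∣ m → d ∣ n → m < n → m + d ≤ n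
∣∧<⇒+≤ {d} (divides i refl) (divides j refl) m<n =
  subst (_≤ j * d) (+-comm d (i * d)) (*-monoˡ-≤ d (*-cancelʳ-< d i j m<n))

∣m+n∣n⇒∣m : ∀ {d m n} → d ∣ m + n → d ∣ n → d ∣ m
∣m+n∣n⇒∣m {d} {m} {n} = ∣m+n∣m⇒∣n ∘ subst (d ∣_) (+-comm m n)

gcd∣⇒∃∣+* : ∀ d a n .{{_ : NonZero d}} → gcd d a ∣ n → ∃[ u ] d ∣ n + u * a
gcd∣⇒∃∣+* d@(suc d-1) a n (divides m refl) with Bézout.identity (gcd-GCD d a)
... | Bézout.Identity.+- x y eq = m * y , divides (m * x) (begin
    m * gcd d a + m * y * a   ≡⟨ rearrange m (gcd d a) y a ⟩
    m * (gcd d a + y * a)     ≡⟨ cong (m *_) eq ⟩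
    m * (x * d)               ≡⟨ *-assoc m x d ⟨
    m * x * d                 ∎)
  where
  open ≡-Reasoning
  rearrange : ∀ m g y a → m * g + m * y * a ≡ m * (g + y * a)
  rearrange = solve-∀
-- Here y a ≡ gcd(d, a) modulo d has the wrong sign, which the factor d - 1 ≡ -1 corrects.
... | Bézout.Identity.-+ x y eq = m * d-1 * y , divides (m * gcd d a + m * d-1 * x) (begin
    m * gcd d a + m * d-1 * y * a
      ≡⟨ cong (λ z → m * gcd d a + z) (*-assoc (m * d-1) y a) ⟩
    m * gcd d a + m * d-1 * (y * a)              ≡⟨ cong (λ z → m * gcd d a + m * d-1 * z) eq ⟨
    m * gcd d a + m * d-1 * (gcd d a + x * d)    ≡⟨ rearrange m (gcd d a) d-1 x ⟩
    (m * gcd d a + m * d-1 * x) * d              ∎)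
  where
  open ≡-Reasoning
  rearrange : ∀ m g d x → m * g + m * d * (g + x * suc d) ≡ (m * g + m * d * x) * suc d
  rearrange = solve-∀

-- Multiples of a fall into q residue classes modulo d = q gcd(d, a).
gcd∣⇒∃<∣+* : ∀ d a n q .{{_ : NonZero d}} .{{_ : NonZero q}} → d ≡ q * gcd d a → gcd d a ∣ n →
             ∃[ v ] v < q × d ∣ n + suc v * a
-- Starting from n + a makes the coefficient of a run through 1, ..., q, so that its complement to q
-- is at most q - 1.
gcd∣⇒∃<∣+* d a n q d≡ g∣n with gcd∣⇒∃∣+* d a (n + a) (∣m∣n⇒∣m+n g∣n (gcd[m,n]∣n d a))
... | u , d∣ = u % q , m%n<n u q ,
  ∣m+n∣m⇒∣n {m = u / q * q * a} (subst (d ∣_) eq d∣) d∣uqa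
  where
  d∣uqa : d ∣ u / q * q * a
  d∣uqa = subst₂ _∣_ (sym d≡) (sym (*-assoc (u / q) q a))
    (∣n⇒∣m*n (u / q) (*-monoʳ-∣ q (gcd[m,n]∣n d a)))
  rearrange : ∀ n a r p → n + a + (r + p) * a ≡ p * a + (n + (a + r * a))
  rearrange = solve-∀
  eq : n + a + u * a ≡ u / q * q * a + (n + suc (u % q) * a)
  eq = trans (cong (λ z → n + a + z * a) (m≡m%n+[m/n]*n u q)) (rearrange n a (u % q) (u / q * q))

-- D counts with the first k coins and D′ with one more coin a.
module Step
  (D D′ : ℕ → ℕ) (d a q : ℕ) .{{_ : NonZero d}} .{{_ : NonZero a}} .{{_ : NonZero q}}
  (D≤D′ : ∀ n → D n ≤ D′ n)
  (D′-shift : ∀ n → D′ n + D (n + q * a) ≤ D′ (n + q * a))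
  (D′-mono : ∀ n j → D′ n ≤ D′ (n + j * a))
  (d≡q*g : d ≡ q * gcd d a)
  -- For t = s + d and t′ = s′ + gcd(d, a) this is s′ = s + (q - 1) a without subtraction; likewise
  -- n + d ≡ t + y means y = n - s.
  (t t′ : ℕ) (t′-def : t′ + d + a ≡ t + q * a + gcd d a)
  (f Q : ℕ → ℚ)
  (f-bound : ∀ n y → d ∣ n → n + d ≡ t + y → f y ℚ.≤ ι (D n))
  (Q-mono : ∀ {y z} → y ≤ z → Q y ℚ.≤ Q z)
  (Q-zero : Q 0 ℚ.≤ 0ℚ)
  (Q-small : ∀ y → y ≤ q * a → Q y ℚ.≤ f y)
  (Q-step : ∀ y → Q (y + q * a) ℚ.≤ Q y ℚ.+ f (y + q * a))
  where

  private
    h = q * a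
    g = gcd d a
    instance
      h≢0 : NonZero h
      h≢0 = m*n≢0 q a

  d∣h : d ∣ h
  d∣h = subst (_∣ h) (sym d≡q*g) (*-monoʳ-∣ q (gcd[m,n]∣n d a))

  -- Descent from n to n - h: each step collects one value of `f` by `Q-step`, and `Q-small` pays
  -- for the remainder y ≤ h.
  bound-multiple : ∀ n → Acc _<_ n → ∀ y → d ∣ n → n + d ≡ t + y → Q y ℚ.≤ ι (D′ n)
  bound-multiple n (acc rec) y d∣n eq with y ≤? h
  ... | yes y≤h = ℚ.≤-trans (Q-small y y≤h)
                    (ℚ.≤-trans (f-bound n y d∣n eq) (ι-mono (D≤D′ n)))
  ... | no y≰h = subst₂ (λ y n → Q y ℚ.≤ ι (D′ n)) y₁+h≡y n₁+h≡n (begin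
      Q (y₁ + h)                            ≤⟨ Q-step y₁ ⟩
      Q y₁ ℚ.+ f (y₁ + h)                   ≤⟨ ℚ.+-mono-≤
                                                (bound-multiple n₁ (rec n₁<n) y₁ d∣n₁ eq₁)
                                                (f-bound (n₁ + h) (y₁ + h) d∣n₁+h eq′) ⟩
      ι (D′ n₁) ℚ.+ ι (D (n₁ + h))          ≡⟨ ι-+ (D′ n₁) (D (n₁ + h)) ⟨
      ι (D′ n₁ + D (n₁ + h))                ≤⟨ ι-mono (D′-shift n₁) ⟩
      ι (D′ (n₁ + h))                       ∎)
    where
    open ℚ.≤-Reasoning
    h<y : h < y
    h<y = ≰⇒> y≰h
    -- If n < h, then n + d ≤ h as both are multiples of d, whereas n + d = t + y ≥ y > h. This uses
    -- s ≥ -d, that is, t ≥ 0.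
    h≤n : h ≤ n
    h≤n = ≮⇒≥ λ n<h → <⇒≱ h<y
      (≤-trans (m≤n+m y t) (≤-trans (≤-reflexive (sym eq)) (∣∧<⇒+≤ d∣n d∣h n<h)))
    n₁ = n ∸ h
    y₁ = y ∸ h
    n₁+h≡n : n₁ + h ≡ n
    n₁+h≡n = m∸n+n≡m h≤n
    y₁+h≡y : y₁ + h ≡ y
    y₁+h≡y = m∸n+n≡m (<⇒≤ h<y)
    n₁<n : n₁ < n
    n₁<n = subst (n₁ <_) n₁+h≡n (m<m+n n₁ (>-nonZero⁻¹ h))
    d∣n₁+h : d ∣ n₁ + h
    d∣n₁+h = subst (d ∣_) (sym n₁+h≡n) d∣n
    d∣n₁ : d ∣ n₁
    d∣n₁ = ∣m+n∣n⇒∣m d∣n₁+h d∣h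
    eq′ : n₁ + h + d ≡ t + (y₁ + h)
    eq′ = subst₂ (λ n y → n + d ≡ t + y) (sym n₁+h≡n) (sym y₁+h≡y) eq
    rearrange₁ : ∀ n d h → n + d + h ≡ n + h + d
    rearrange₁ = solve-∀
    eq₁ : n₁ + d ≡ t + y₁
    eq₁ = +-cancelʳ-≡ h (n₁ + d) (t + y₁)
      (trans (rearrange₁ n₁ d h) (trans eq′ (sym (+-assoc t y₁ h))))

  -- With v + w = q - 1, the number n₁ = n - w a is a multiple of d and n₁ - s = y + v a ≥ y, so
  -- monotonicity of `Q` reduces the claim to `bound-multiple`.
  bound : ∀ n y → g ∣ n → n + g ≡ t′ + y → Q y ℚ.≤ ι (D′ n)
  bound n y g∣n eq with gcd∣⇒∃<∣+* d a n q d≡q*g g∣n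
  ... | v , v<q , d∣ with m≤n⇒∃[o]m+o≡n v<q
  ... | w , refl with w * a ≤? n
  ... | yes wa≤n = ℚ.≤-trans (Q-mono (m≤m+n y (v * a)))
        (ℚ.≤-trans (bound-multiple n₁ (<-wellFounded n₁) (y + v * a) d∣n₁ eq₁)
          (subst (λ n → ι (D′ n₁) ℚ.≤ ι (D′ n)) n₁+wa≡n (ι-mono (D′-mono n₁ w))))
    where
    n₁ = n ∸ w * a
    n₁+wa≡n : n₁ + w * a ≡ n
    n₁+wa≡n = m∸n+n≡m wa≤n
    rearrange₁ : ∀ n w v a → n + w * a + (a + v * a) ≡ n + (suc v + w) * a
    rearrange₁ = solve-∀
    d∣n₁ : d ∣ n₁
    d∣n₁ = ∣m+n∣n⇒∣m
      (subst (d ∣_) (trans (cong (_+ suc v * a) (sym n₁+wa≡n)) (rearrange₁ n₁ w v a)) d∣) d∣h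
    rearrange₂ : ∀ n d t′ w a g → n + d + (t′ + w * a + a + g) ≡ (n + w * a + g) + (t′ + d + a)
    rearrange₂ = solve-∀
    rearrange₃ : ∀ t t′ y v w a g → (t′ + y) + (t + (suc v + w) * a + g)
                 ≡ t + (y + v * a) + (t′ + w * a + a + g)
    rearrange₃ = solve-∀
    eq₁ : n₁ + d ≡ t + (y + v * a)
    eq₁ = +-cancelʳ-≡ (t′ + w * a + a + g) _ _ (begin
      n₁ + d + (t′ + w * a + a + g)              ≡⟨ rearrange₂ n₁ d t′ w a g ⟩
      (n₁ + w * a + g) + (t′ + d + a)
        ≡⟨ cong₂ _+_ (trans (cong (_+ g) n₁+wa≡n) eq) t′-def ⟩
      (t′ + y) + (t + (suc v + w) * a + g)       ≡⟨ rearrange₃ t t′ y v w a g ⟩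
      t + (y + v * a) + (t′ + w * a + a + g)     ∎)
      where open ≡-Reasoning
  -- Here the largest n₁ ≡ n (mod a) divisible by d would be negative, which
  -- leaves only y = 0, where the bound is trivial.
  ... | no wa≰n = subst (λ y → Q y ℚ.≤ ι (D′ n)) (sym y≡0)
                    (ℚ.≤-trans Q-zero (ι-mono {0} {D′ n} z≤n))
    where
    m = n + suc v * a
    rearrange₁ : ∀ w v a → w * a + suc v * a ≡ (suc v + w) * a
    rearrange₁ = solve-∀
    m<h : m < h
    m<h = subst (m <_) (rearrange₁ w v a) (+-monoˡ-< (suc v * a) (≰⇒> wa≰n))
    y≡0 : y ≡ 0
    y≡0 = n≤0⇒n≡0 (+-cancelˡ-≤ (t + h + g + t′) y 0 (begin
      (t + h + g + t′) + y               ≡⟨ rearrange₂ t h g t′ y ⟩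
      (t′ + y) + (t + h + g)             ≡⟨ cong₂ _+_ eq t′-def ⟨
      (n + g) + (t′ + d + a)             ≤⟨ m≤m+n _ (v * a) ⟩
      (n + g) + (t′ + d + a) + v * a     ≡⟨ rearrange₃ n g t′ d a v ⟩
      (m + d) + (g + t′)                 ≤⟨ +-monoˡ-≤ (g + t′) (∣∧<⇒+≤ d∣ d∣h m<h) ⟩
      h + (g + t′)                       ≤⟨ m≤n+m _ t ⟩
      t + (h + (g + t′))                 ≡⟨ rearrange₄ t h g t′ ⟩
      (t + h + g + t′) + 0               ∎))
      where
      open ≤-Reasoning
      rearrange₂ : ∀ t h g t′ y → (t + h + g + t′) + y ≡ (t′ + y) + (t + h + g)
      rearrange₂ = solve-∀
      rearrange₃ : ∀ n g t′ d a v → (n + g) + (t′ + d + a) + v * a ≡ (n + (a + v * a) + d) + (g + t′)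
      rearrange₃ = solve-∀
      rearrange₄ : ∀ t h g t′ → t + (h + (g + t′)) ≡ (t + h + g + t′) + 0
      rearrange₄ = solve-∀

-- The lower bound

pos-^ : ∀ y e → (+ y) ℤ.^ e ≡ + (y ^ e)
pos-^ y zero    = refl
pos-^ y (suc e) = trans (cong (+ y ℤ.*_) (pos-^ y e)) (sym (ℤ.pos-* y (y ^ e)))

positive : ℕ → ℚ
positive zero    = 0ℚ
positive (suc _) = 1ℚ

positive-nonZero : ∀ n .{{_ : NonZero n}} → positive n ≡ 1ℚ
positive-nonZero (suc _) = refl

module _ (a : ℕ → ℕ) (a⁺ : ∀ i → NonZero (a (suc i))) where

  ratio : ℕ → ℕ
  ratio j = _/_ (d a (suc j)) (d a (suc (suc j))) {{d≢0 a a⁺ (suc j)}}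

  d≡ratio*d : ∀ j → d a (suc j) ≡ ratio j * d a (suc (suc j))
  d≡ratio*d j = sym (m/n*n≡m {{d≢0 a a⁺ (suc j)}} (gcd[m,n]∣m (d a (suc j)) (a (suc (suc j)))))

  ratio≢0 : ∀ j → NonZero (ratio j)
  ratio≢0 j = m*n≢0⇒m≢0 (ratio j) {{subst NonZero (d≡ratio*d j) (d≢0 a a⁺ j)}}

  -- t k = s⁻ k + d k, which unlike s⁻ k is always a natural number.
  t : ℕ → ℕ
  t zero          = 0
  t (suc zero)    = 0
  t (suc (suc j)) = t (suc j) + pred (ratio j) * (a (suc (suc j)) ∸ d a (suc (suc j)))

  -- Since d = q g, the increment (q - 1) a + g - d of s⁻ + d equals (q - 1)(a - g); the truncated
  -- subtraction is exact because g divides a > 0.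
  t-suc : ∀ j → t (suc (suc j)) + d a (suc j) + a (suc (suc j))
                ≡ t (suc j) + ratio j * a (suc (suc j)) + d a (suc (suc j))
  t-suc j = begin
    t₀ + pred q * (A ∸ g) + d a (suc j) + A
      ≡⟨ cong (λ z → t₀ + pred q * (A ∸ g) + z + A) (trans (d≡ratio*d j) (cong (_* g) q≡)) ⟩
    t₀ + pred q * (A ∸ g) + suc (pred q) * g + A         ≡⟨ rearrange t₀ (pred q) (A ∸ g) g A ⟩
    t₀ + (pred q * ((A ∸ g) + g) + A) + g
      ≡⟨ cong (λ z → t₀ + (pred q * z + A) + g) (m∸n+n≡m g≤A) ⟩
    t₀ + (pred q * A + A) + g
      ≡⟨ cong (λ z → t₀ + z + g) (+-comm (pred q * A) A) ⟩
    t₀ + suc (pred q) * A + g                            ≡⟨ cong (λ z → t₀ + z * A + g) q≡ ⟨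
    t₀ + q * A + g                                       ∎
    where
    open ≡-Reasoning
    t₀ = t (suc j)
    q = ratio j
    A = a (suc (suc j))
    g = d a (suc (suc j))
    q≡ : q ≡ suc (pred q)
    q≡ = sym (suc-pred q {{ratio≢0 j}})
    g≤A : g ≤ A
    g≤A = ∣⇒≤ {{a⁺ (suc j)}} (gcd[m,n]∣n (d a (suc j)) A)
    rearrange : ∀ t p b g A → t + p * b + suc p * g + A ≡ t + (p * (b + g) + A) + g
    rearrange = solve-∀

  s⁻+d≡t : ∀ j → s⁻ a a⁺ (suc j) ℤ.+ + d a (suc j) ≡ + t (suc j)
  s⁻+d≡t zero    = trans (cong (λ z → ℤ.- + a 1 ℤ.+ + z) (gcd-identityˡ (a 1)))
                         (ℤ.+-inverseˡ (+ a 1))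
  s⁻+d≡t (suc j) = ∙-cancelʳ (+ d₀ ℤ.+ + A) _ _ (begin
    s ℤ.+ (+ q ℤ.- + 1) ℤ.* + A ℤ.+ + g ℤ.+ (+ d₀ ℤ.+ + A)
      ≡⟨ rearrange s (+ q) (+ A) (+ g) (+ d₀) ⟩
    (s ℤ.+ + d₀) ℤ.+ + q ℤ.* + A ℤ.+ + g
      ≡⟨ cong₂ (λ x y → x ℤ.+ y ℤ.+ + g) (s⁻+d≡t j) (sym (ℤ.pos-* q A)) ⟩
    + (t (suc j) + q * A + g)                                 ≡⟨ cong +_ (t-suc j) ⟨
    + (t (suc (suc j)) + d₀ + A)
      ≡⟨ cong +_ (+-assoc (t (suc (suc j))) d₀ A) ⟩
    + t (suc (suc j)) ℤ.+ (+ d₀ ℤ.+ + A)                      ∎)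
    where
    open ≡-Reasoning
    s = s⁻ a a⁺ (suc j)
    q = ratio j
    A = a (suc (suc j))
    g = d a (suc (suc j))
    d₀ = d a (suc j)
    rearrange : ∀ s q A g d → s ℤ.+ (q ℤ.- + 1) ℤ.* A ℤ.+ g ℤ.+ (d ℤ.+ A)
                ≡ (s ℤ.+ d) ℤ.+ q ℤ.* A ℤ.+ g
    rearrange = ℤ-Solver.solve-∀

  -- The induction statement for k = j + 1. The equation says y = n - s⁻_k, and `y` being natural
  -- encodes n ≥ s⁻_k.
  BoundsDenumerant : ℕ → (ℕ → ℚ) → Set
  BoundsDenumerant j f = ∀ n y → d a (suc j) ∣ n → n + d a (suc j) ≡ t (suc j) + y →
                         f y ℚ.≤ ι (denumerant a (suc j) n)

  bounds-suc : ∀ j f Q →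
    (∀ {y z} → y ≤ z → Q y ℚ.≤ Q z) → Q 0 ℚ.≤ 0ℚ →
    (∀ y → y ≤ ratio j * a (suc (suc j)) → Q y ℚ.≤ f y) →
    (∀ y → Q (y + ratio j * a (suc (suc j))) ℚ.≤ Q y ℚ.+ f (y + ratio j * a (suc (suc j)))) →
    BoundsDenumerant j f → BoundsDenumerant (suc j) Q
  bounds-suc j f Q mono zro small step f-bound =
    Step.bound (denumerant a (suc j)) (denumerant a (suc (suc j)))
      (d a (suc j)) (a (suc (suc j))) (ratio j)
      {{d≢0 a a⁺ j}} {{a⁺ (suc j)}} {{ratio≢0 j}}
      (denumerant-mono a a⁺ (suc j))
      (λ n → denumerant-+* a a⁺ (suc j) n (ratio j) {{ratio≢0 j}})
      (denumerant-mono-* a a⁺ (suc j))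
      (d≡ratio*d j) (t (suc j)) (t (suc (suc j))) (t-suc j) f Q f-bound mono zro small step

  bounds-one : BoundsDenumerant 0 positive
  bounds-one n zero    _ eq = ⊥-elim (≢-nonZero⁻¹ (d a 1) {{d≢0 a a⁺ 0}} (m+n≡0⇒n≡0 n eq))
  -- The empty tuple gives D_0(0) = 1; a last entry 0 is appended and then raised x times.
  bounds-one n (suc y) (divides x refl) _ = ι-mono (≤-trans (denumerant-mono a a⁺ 0 0)
    (subst (λ z → denumerant a 1 0 ≤ denumerant a 1 (x * z)) (sym (gcd-identityˡ (a 1)))
      (denumerant-mono-* a a⁺ 0 0 x)))

  c : ℕ → ℚ
  c j = _÷_ (d a (suc j)) (∏ a (suc j)) {{∏≢0 a a⁺ (suc j)}}

  c-nonNeg : ∀ j → ℚ.NonNegative (c j)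
  c-nonNeg j = ÷-nonNeg (d a (suc j)) (∏ a (suc j)) {{∏≢0 a a⁺ (suc j)}}

  -- Multiplying by h = q a removes the new coin from the product and turns d_{k+1} into q d_{k+1} =
  -- d_k.
  c-suc : ∀ j → c (suc j) ℚ.* ι (ratio j * a (suc (suc j))) ≡ c j
  c-suc j = trans (÷-* g (p * A) (q * A) 1)
    (÷-cong (g * (q * A)) (p * A * 1) (d a (suc j)) p
      (trans (rearrange g q A p) (cong (_* (p * A * 1)) (sym (d≡ratio*d j)))))
    where
    q = ratio j
    A = a (suc (suc j))
    g = d a (suc (suc j))
    p = ∏ a (suc j)
    instance
      p≢0 : NonZero p
      p≢0 = ∏≢0 a a⁺ (suc j)
      pA≢0 : NonZero (p * A)
      pA≢0 = ∏≢0 a a⁺ (suc (suc j))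
      pA1≢0 : NonZero (p * A * 1)
      pA1≢0 = m*n≢0 (p * A) 1
    rearrange : ∀ g q A p → g * (q * A) * p ≡ q * g * (p * A * 1)
    rearrange = solve-∀

  -- The function f_k of the opening comment for k = m + 2.
  P : ℕ → ℕ → ℚ
  P m y = c (suc m) ℚ.* bfSum a m (pw y)

  P-mono : ∀ m {y z} → y ≤ z → P m y ℚ.≤ P m z
  P-mono m y≤z = ℚ.*-monoˡ-≤-nonNeg (c (suc m)) {{c-nonNeg (suc m)}}
    (bfSum-mono a m λ e → pw-mono e y≤z)

  P-zero : ∀ m → P m 0 ≡ 0ℚ
  P-zero m = begin
    c (suc m) ℚ.* bfSum a m (pw 0)
      -- Writing 0 as a multiple of `pw 0 e` lets linearity pull the factor 0 out of the sum.
      ≡⟨ cong (c (suc m) ℚ.*_) (bfSum-cong a m λ e → trans (pw-0 e) (sym (ℚ.*-zeroˡ (pw 0 e)))) ⟩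
    c (suc m) ℚ.* bfSum a m (λ e → 0ℚ ℚ.* pw 0 e)
      ≡⟨ cong (c (suc m) ℚ.*_) (trans (bfSum-* a m 0ℚ (pw 0)) (ℚ.*-zeroˡ (bfSum a m (pw 0)))) ⟩
    c (suc m) ℚ.* 0ℚ                              ≡⟨ ℚ.*-zeroʳ (c (suc m)) ⟩
    0ℚ                                            ∎
    where
    open ≡-Reasoning
    pw-0 : ∀ e .{{_ : NonZero e}} → pw 0 e ≡ 0ℚ
    pw-0 (suc e) = pw-zero e

  P₀-linear : ∀ y → P 0 y ≡ c 1 ℚ.* ι y
  P₀-linear y = cong (c 1 ℚ.*_) (trans (ℚ.*-identityˡ (pw y 1))
    (÷-cong (y ^ 1) 1 y 1 (cong (_* 1) (*-identityʳ y))))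

  c₀≡1 : c 0 ≡ 1ℚ
  c₀≡1 = ÷-cong (d a 1) (∏ a 1) 1 1 {{∏≢0 a a⁺ 1}}
    (trans (*-identityʳ (d a 1)) (trans (gcd-identityˡ (a 1))
      (sym (trans (*-identityˡ (∏ a 1)) (*-identityˡ (a 1))))))

  -- A separate step, since `positive` is not a weighted sum of powers. Here `P 0 y` is y/h, which
  -- grows by exactly 1 over each step of length h.
  bounds-two : BoundsDenumerant 1 (P 0)
  bounds-two = bounds-suc 0 positive (P 0) (P-mono 0) (ℚ.≤-reflexive (P-zero 0)) small step bounds-one
    where
    h = ratio 0 * a 2
    instance
      h≢0 : NonZero h
      h≢0 = m*n≢0 (ratio 0) (a 2) {{ratio≢0 0}} {{a⁺ 1}}
    P₀h≡1 : P 0 h ≡ 1ℚ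
    P₀h≡1 = trans (P₀-linear h) (trans (c-suc 0) c₀≡1)
    small : ∀ y → y ≤ h → P 0 y ℚ.≤ positive y
    small zero    _   = ℚ.≤-reflexive (P-zero 0)
    small (suc y) y≤h = ℚ.≤-trans (P-mono 0 y≤h) (ℚ.≤-reflexive P₀h≡1)
    step : ∀ y → P 0 (y + h) ℚ.≤ P 0 y ℚ.+ positive (y + h)
    step y = ℚ.≤-reflexive (begin
      P 0 (y + h)                               ≡⟨ P₀-linear (y + h) ⟩
      c 1 ℚ.* ι (y + h)                         ≡⟨ cong (c 1 ℚ.*_) (ι-+ y h) ⟩
      c 1 ℚ.* (ι y ℚ.+ ι h)                     ≡⟨ ℚ.*-distribˡ-+ (c 1) (ι y) (ι h) ⟩
      c 1 ℚ.* ι y ℚ.+ c 1 ℚ.* ι h               ≡⟨ cong₂ ℚ._+_ (P₀-linear y) (P₀-linear h) ⟨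
      P 0 y ℚ.+ P 0 h
        ≡⟨ cong (P 0 y ℚ.+_) (trans P₀h≡1 (sym positive-y+h)) ⟩
      P 0 y ℚ.+ positive (y + h)                ∎)
      where
      open ≡-Reasoning
      positive-y+h : positive (y + h) ≡ 1ℚ
      positive-y+h = positive-nonZero (y + h) {{>-nonZero (m≤n⇒m≤o+n y (>-nonZero⁻¹ h))}}

  -- The factor h, the same for all exponents, is absorbed by the constant through `c-suc`.
  c*bfSum-ι*≡P : ∀ m y → let h = ratio (suc m) * a (3 + m) in
             c (2 + m) ℚ.* bfSum a m (λ e → ι h ℚ.* pw y e) ≡ P m y
  c*bfSum-ι*≡P m y = begin
    c (2 + m) ℚ.* bfSum a m (λ e → ι h ℚ.* pw y e)    ≡⟨ cong (c (2 + m) ℚ.*_) (bfSum-* a m (ι h) (pw y)) ⟩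
    c (2 + m) ℚ.* (ι h ℚ.* bfSum a m (pw y))          ≡⟨ ℚ.*-assoc (c (2 + m)) (ι h) (bfSum a m (pw y)) ⟨
    c (2 + m) ℚ.* ι h ℚ.* bfSum a m (pw y)            ≡⟨ cong (ℚ._* bfSum a m (pw y)) (c-suc (suc m)) ⟩
    P m y                                         ∎
    where
    open ≡-Reasoning
    h = ratio (suc m) * a (3 + m)

  -- `bfSum-suc` expresses `P (suc m)` with the weights of `P m`, so both conditions on the new
  -- bound reduce to `pw-small` and `pw-step` at each exponent.
  P-bounds : ∀ m → BoundsDenumerant (suc m) (P m)
  P-bounds zero    = bounds-two
  P-bounds (suc m) = bounds-suc (suc m) (P m) (P (suc m))
    (P-mono (suc m)) (ℚ.≤-reflexive (P-zero (suc m))) small step (P-bounds m)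
    where
    open ℚ.≤-Reasoning
    h = ratio (suc m) * a (3 + m)
    G : ℕ → ℕ → ℚ
    G y e = pw y (suc e) ℚ.+ (a (suc m + 2) ÷ 2) ℚ.* pw y e
    a≤h : a (suc m + 2) ≤ h
    a≤h = subst (λ i → a (suc i) ≤ h) (+-comm 2 m)
      (m≤n*m (a (3 + m)) (ratio (suc m)) {{ratio≢0 (suc m)}})
    P-suc : ∀ y → P (suc m) y ≡ c (2 + m) ℚ.* bfSum a m (G y)
    P-suc y = cong (c (2 + m) ℚ.*_) (bfSum-suc a m (pw y))
    c-mono : ∀ {p r} → p ℚ.≤ r → c (2 + m) ℚ.* p ℚ.≤ c (2 + m) ℚ.* r
    c-mono = ℚ.*-monoˡ-≤-nonNeg (c (2 + m)) {{c-nonNeg (2 + m)}}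
    small : ∀ y → y ≤ h → P (suc m) y ℚ.≤ P m y
    small y y≤h = begin
      P (suc m) y                                   ≡⟨ P-suc y ⟩
      c (2 + m) ℚ.* bfSum a m (G y)
        ≤⟨ c-mono (bfSum-mono a m λ e → pw-small e y≤h a≤h) ⟩
      c (2 + m) ℚ.* bfSum a m (λ e → ι h ℚ.* pw y e)    ≡⟨ c*bfSum-ι*≡P m y ⟩
      P m y                                         ∎
    step : ∀ y → P (suc m) (y + h) ℚ.≤ P (suc m) y ℚ.+ P m (y + h)
    step y = begin
      P (suc m) (y + h)                             ≡⟨ P-suc (y + h) ⟩
      c (2 + m) ℚ.* bfSum a m (G (y + h))               ≤⟨ c-mono (bfSum-mono a m λ e → pw-step e y a≤h) ⟩
      c (2 + m) ℚ.* bfSum a m (λ e → G y e ℚ.+ ι h ℚ.* pw (y + h) e)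
        ≡⟨ cong (c (2 + m) ℚ.*_) (bfSum-+ a m (G y) (λ e → ι h ℚ.* pw (y + h) e)) ⟩
      c (2 + m) ℚ.* (bfSum a m (G y) ℚ.+ bfSum a m (λ e → ι h ℚ.* pw (y + h) e))
        ≡⟨ ℚ.*-distribˡ-+ (c (2 + m)) (bfSum a m (G y)) (bfSum a m (λ e → ι h ℚ.* pw (y + h) e)) ⟩
      c (2 + m) ℚ.* bfSum a m (G y) ℚ.+ c (2 + m) ℚ.* bfSum a m (λ e → ι h ℚ.* pw (y + h) e)
        ≡⟨ cong₂ ℚ._+_ (sym (P-suc y)) (c*bfSum-ι*≡P m (y + h)) ⟩
      P (suc m) y ℚ.+ P m (y + h)                   ∎

  -- With d_k = 1 every n is a multiple of d_k, and `s⁻+d≡t` translates y = n - s⁻_k into natural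
  -- numbers.
  lower-bound : ∀ m n y → d a (2 + m) ≡ 1 → + n ℤ.- s⁻ a a⁺ (2 + m) ≡ + y →
                P m y ℚ.≤ ι (denumerant a (2 + m) n)
  lower-bound m n y d≡1 eq = P-bounds m n y (subst (_∣ n) (sym d≡1) (1∣ n)) (ℤ.+-injective (begin
    + n ℤ.+ + g                       ≡⟨ rearrange (+ n) (s⁻ a a⁺ (2 + m)) (+ g) ⟩
    (s⁻ a a⁺ (2 + m) ℤ.+ + g) ℤ.+ (+ n ℤ.- s⁻ a a⁺ (2 + m))  ≡⟨ cong₂ ℤ._+_ (s⁻+d≡t (suc m)) eq ⟩
    + t (2 + m) ℤ.+ + y               ∎))
    where
    open ≡-Reasoning
    g = d a (2 + m)
    rearrange : ∀ n s g → n ℤ.+ g ≡ (s ℤ.+ g) ℤ.+ (n ℤ.- s)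
    rearrange = ℤ-Solver.solve-∀

lemma4p2 : (a : ℕ → ℕ) (a⁺ : ∀ i → NonZero (a (suc i))) →
    (k : ℕ) → 2 ≤ k → d a k ≡ 1 →
    (n : ℕ) → s⁻ a a⁺ k ℤ.≤ + n →
    (+ denumerant a k n ℚ./ 1)
    ℚ.≥ (ℚ._/_ (+ 1) (∏ a k) {{∏≢0 a a⁺ k}})
    ℚ.* ∑[0≤i≤ k ∸ 2 ] (λ i →
    blomFröberg a 2 (+ (k ∸ 2)) (+ i)
    ℚ.* (ℚ._/_ ((+ n ℤ.- s⁻ a a⁺ k) ℤ.^ (k ∸ 1 ∸ i)) ((k ∸ 1 ∸ i) !) {{(k ∸ 1 ∸ i) !≢0}}))
lemma4p2 a a⁺ (suc (suc m)) (s≤s (s≤s _)) d≡1 n s≤n =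
  subst (ℚ._≤ ι (denumerant a (2 + m) n)) P≡ (lower-bound a a⁺ m n y d≡1 (sym y≡))
  where
  y = ℤ.∣ + n ℤ.- s⁻ a a⁺ (2 + m) ∣
  y≡ : + y ≡ + n ℤ.- s⁻ a a⁺ (2 + m)
  y≡ = ℤ.0≤i⇒+∣i∣≡i (ℤ.i≤j⇒0≤j-i s≤n)
  -- The numerator d_k of the constant becomes 1, and the powers of `y` become integer powers of n -
  -- s⁻_k.
  P≡ = cong₂ ℚ._*_
    (cong (λ z → _÷_ z (∏ a (2 + m)) {{∏≢0 a a⁺ (2 + m)}}) d≡1)
    (∑-cong m λ i _ → cong (blomFröberg a 2 (+ m) (+ i) ℚ.*_)
      (cong (λ z → ℚ._/_ z ((suc m ∸ i) !) {{(suc m ∸ i) !≢0}})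
        (trans (sym (pos-^ y (suc m ∸ i))) (cong (ℤ._^ (suc m ∸ i)) y≡))))
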